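{- For all integers $q \geq 2$ and $t \geq 2$, \[\tilde{r}_q (K_{t,t}) \leq 48\, q^{t+2}\, t^{3-1/q} \,(\log_q t)^{1/q}.\]
   Context: For a natural number $q$ and a graph $G$, the $q$-colour on-line Ramsey number $\tilde{r}_q(G)$ is defined via the following game between Builder and Painter, played on an initially edgeless graph with an unlimited supply of vertices: in each round Builder draws a new edge, and Painter immediately colours it with one of $q$ colours. Builder wins once the coloured graph contains a monochromatic copy of $G$. $\tilde{r}_q(G)$ is the minimum number of edges Builder must draw to guarantee a win, regardless of Painter's strategy. $K_{t,t}$ is the complete bipartite graph with $t$ vertices in each part. -}

module Defs where

open import Data.Nat using (ℕ; zero; suc; _+_; _*_; _^_; _≤_)
open import Data.Fin using (Fin)
open import Data.Product using (Σ; _×_; ∃; _,_)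
open import Data.Sum using (_⊎_)
open import Data.List using (List; []; _∷_)
open import Data.List.Membership.Propositional using (_∈_)
open import Relation.Binary.PropositionalEquality using (_≡_; _≢_)
open import Relation.Nullary using (¬_)
open import Function.Definitions using (Injective)

-- A coloured edge: endpoints u v (vertices are natural numbers, an unlimited
-- supply) together with one of q colours.
record CEdge (q : ℕ) : Set where
  constructor edge
  field
    u : ℕ
    v : ℕ
    col : Fin q

Board : ℕ → Set
Board q = List (CEdge q)

HasEdge : ∀ {q} → Board q → ℕ → ℕ → Fin q → Set
HasEdge B x y c = (edge x y c ∈ B) ⊎ (edge y x c ∈ B)

HasMonoKtt : ∀ {q} → ℕ → Board q → Set
HasMonoKtt {q} t B =
  Σ (Fin q) λ c → Σ (Fin t → ℕ) λ f → Σ (Fin t → ℕ) λ g →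
    Injective _≡_ _≡_ f × Injective _≡_ _≡_ g ×
    (∀ i j → f i ≢ g j) ×
    (∀ i j → HasEdge B (f i) (g j) c)

NewEdge : ∀ {q} → Board q → ℕ → ℕ → Set
NewEdge {q} B x y = (x ≢ y) × (∀ (c : Fin q) → ¬ HasEdge B x y c)

BuilderWinsIn : (q t : ℕ) → ℕ → Board q → Set
BuilderWinsIn q t zero B = HasMonoKtt t B
BuilderWinsIn q t (suc n) B =
  HasMonoKtt t B ⊎
  Σ ℕ λ x → Σ ℕ λ y → NewEdge B x y ×
    (∀ (c : Fin q) → BuilderWinsIn q t n (edge x y c ∷ B))

OnlineRamseyKttAtMost : (q t N : ℕ) → Set
OnlineRamseyKttAtMost q t N = BuilderWinsIn q t N []

{-# OPTIONS --safe #-}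
module Submission where

-- Builder plays in two stages. Let a be maximal with t ^ (q ^ (q a)) ≤ q ^ t, that is
-- q ^ (q a) ≤ t / log_q t. First, n₁ ≈ t q ^ (t + (q - 1) a) vertices are joined to m₁ ≈ a q³ t
-- others. If many of the n₁ vertices have a colour degree exceeding m₁ / q by t, double counting of
-- t-sets already yields a monochromatic K_{t,t}. Otherwise many have all q colour degrees close
-- to m₁ / q, and double counting of q-tuples of a-sets yields n₂ ≈ t q ^ (t - a) of them and, for
-- every colour c, an a-set S_c joined to all n₂ vertices in colour c. These n₂ vertices are then
-- joined to 2 q t² new vertices: by convexity some t of them share t - a neighbours in one colour c,
-- and S_c completes the K_{t,t}. The choice of a balances the costs n₁ m₁ and 2 q t² n₂.

open import Defs
open import Data.Nat using (ℕ; zero; suc; pred; _+_; _*_; _^_; _≤_; _<_; _∸_; z≤n; s≤s; NonZero; >-nonZero)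
open import Data.Nat.Properties hiding (suc-injective)
open import Data.Nat.Tactic.RingSolver using (solve-∀)
open import Data.Fin using (Fin; zero; suc; toℕ; punchIn; splitAt; join; combine; quotient) renaming (_≟_ to _≟ᶠ_)
open import Data.Fin.Properties using (punchIn-injective; punchInᵢ≢i; suc-injective; toℕ-injective; toℕ<n; any?; join-splitAt; remQuot-combine; combine-injectiveʳ)
open import Data.Bool using (if_then_else_)
open import Data.Product using (Σ; ∃; _×_; _,_; proj₁; proj₂)
open import Data.Sum using (_⊎_; inj₁; inj₂; [_,_]′)
open import Data.List using ([]; _∷_)
open import Data.List.Membership.Propositional using (_∈_)
open import Data.List.Relation.Unary.Any using (here; there)
open import Data.List.Relation.Binary.Subset.Propositional using (_⊆_)
open import Data.Empty using (⊥-elim)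
open import Function using (_∘_; id)
open import Function.Definitions using (Injective)
open import Relation.Nullary using (¬_; Dec; yes; no; does; contradiction)
open import Relation.Binary.PropositionalEquality using (_≡_; _≢_; refl; sym; trans; cong; cong₂; subst)
open import Algebra.Properties.Semiring.Sum +-*-semiring using (sum; sum-remove; sum-cong-≗; ∑-comm; ∑-distrib-+; *-distribˡ-sum)

private variable
  q n m : ℕ

-- Sums and powers

sum-mono-≤ : {f g : Fin n → ℕ} → (∀ i → f i ≤ g i) → sum f ≤ sum g
sum-mono-≤ {zero}  f≤g = z≤n
sum-mono-≤ {suc n} f≤g = +-mono-≤ (f≤g zero) (sum-mono-≤ (f≤g ∘ suc))

sum-const : ∀ n c → sum {n} (λ _ → c) ≡ n * c
sum-const zero    c = refl
sum-const (suc n) c = cong (c +_) (sum-const n c)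

term≤sum : (f : Fin n → ℕ) (i : Fin n) → f i ≤ sum f
term≤sum f zero    = m≤m+n _ _
term≤sum f (suc i) = ≤-trans (term≤sum (f ∘ suc) i) (m≤n+m _ (f zero))

pigeonhole : ∀ C (f : Fin n → ℕ) → n * C < sum f → ∃ λ i → C < f i
pigeonhole {suc n} C f lt with C <? f zero
... | yes C<f = zero , C<f
... | no  C≮f with pigeonhole C (f ∘ suc) (+-cancelˡ-< C _ _ (<-≤-trans lt (+-monoˡ-≤ _ (≮⇒≥ C≮f))))
...   | i , C<f = suc i , C<f

-- Each index is charged to a side that it satisfies; as `a + b ≤ n`, the left side collects `a`
-- indices or the right side collects `b`.
pigeonhole₂ : ∀ a b {A B} (f g : Fin n → ℕ) → a + b ≤ n → (∀ i → A ≤ f i ⊎ B ≤ g i) →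
              a * A ≤ sum f ⊎ b * B ≤ sum g
pigeonhole₂ zero    b       f g le p = inj₁ z≤n
pigeonhole₂ (suc a) zero    f g le p = inj₂ z≤n
pigeonhole₂ (suc a) (suc b) {A} {B} f g (s≤s le) p with p zero
... | inj₁ A≤f with pigeonhole₂ a (suc b) (f ∘ suc) (g ∘ suc) le (p ∘ suc)
...   | inj₁ r = inj₁ (+-mono-≤ A≤f r)
...   | inj₂ r = inj₂ (≤-trans r (m≤n+m _ (g zero)))
pigeonhole₂ (suc a) (suc b) {A} {B} f g (s≤s le) p | inj₂ B≤g
  with pigeonhole₂ (suc a) b (f ∘ suc) (g ∘ suc) (≤-trans (≤-reflexive (sym (+-suc a b))) le) (p ∘ suc)
... | inj₁ r = inj₁ (≤-trans r (m≤n+m _ (f zero)))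
... | inj₂ r = inj₂ (+-mono-≤ B≤g r)

-- Weights are 0 or 1, so their total counts the nonzero ones.
support : ∀ T (ω : Fin n → ℕ) → (∀ i → ω i ≤ 1) → T ≤ sum ω →
          Σ (Fin T → Fin n) λ g → Injective _≡_ _≡_ g × (∀ i → ω (g i) ≢ 0)
support zero    ω ω≤1 le = (λ ()) , (λ {}) , λ ()
support {suc n} (suc T) ω ω≤1 le with ω zero in eq | ω≤1 zero
... | zero | _ with support (suc T) (ω ∘ suc) (ω≤1 ∘ suc) le
...   | g , g-inj , g≢0 = suc ∘ g , g-inj ∘ suc-injective , g≢0
support {suc n} (suc T) ω ω≤1 (s≤s le) | suc zero | _ with support T (ω ∘ suc) (ω≤1 ∘ suc) le
... | g , g-inj , g≢0 = g′ , g′-inj _ _ , g′≢0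
  where
  g′ : Fin (suc T) → Fin (suc n)
  g′ zero    = zero
  g′ (suc i) = suc (g i)
  g′-inj : ∀ i j → g′ i ≡ g′ j → i ≡ j
  g′-inj zero    zero    _  = refl
  g′-inj (suc i) (suc j) eq = cong suc (g-inj (suc-injective eq))
  g′≢0 : ∀ i → ω (g′ i) ≢ 0
  g′≢0 zero    ω≡0 with () ← trans (sym eq) ω≡0
  g′≢0 (suc i) = g≢0 i
support (suc T) ω ω≤1 le | suc (suc _) | s≤s ()

rearrangement : ∀ {a b c d} → a ≤ b → c ≤ d → a * d + b * c ≤ a * c + b * d
rearrangement {a} {b} {c} {d} a≤b c≤d
  with x , refl ← m≤n⇒∃[o]m+o≡n a≤b | y , refl ← m≤n⇒∃[o]m+o≡n c≤d =
  ≤-trans (m≤m+n _ (x * y)) (≤-reflexive (expand a x c y))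
  where
  expand : ∀ a x c y → a * (c + y) + (a + x) * c + x * y ≡ a * c + (a + x) * (c + y)
  expand = solve-∀

-- (x - P) (x ^ h - P ^ h) ≥ 0, without subtraction.
power-chebyshev : ∀ h x P → P ^ h * x + P * x ^ h ≤ x ^ suc h + P ^ suc h
power-chebyshev h x P with ≤-total x P
... | inj₁ x≤P = ≤-trans (≤-reflexive (cong (_+ P * x ^ h) (*-comm (P ^ h) x))) (rearrangement x≤P (^-monoˡ-≤ h x≤P))
... | inj₂ P≤x = ≤-trans (≤-reflexive (trans (+-comm (P ^ h * x) _) (cong (P * x ^ h +_) (*-comm (P ^ h) x))))
                   (≤-trans (rearrangement P≤x (^-monoˡ-≤ h P≤x)) (≤-reflexive (+-comm (P * P ^ h) _)))

-- Induction on `h`: `power-chebyshev` is summed over the colours, and its two mixed sums are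
-- bounded below by the hypothesis and by the case `h`. Adding `q * P ^ suc h` to both sides stands
-- in for subtraction.
power-mean : ∀ h P (f : Fin q → ℕ) → q * P ≤ sum f → q * P ^ h ≤ sum (λ c → f c ^ h)
power-mean {q} zero    P f le = ≤-reflexive (sym (sum-const q 1))
power-mean {q} (suc h) P f le = +-cancelʳ-≤ (q * P ^ suc h) _ _ (begin
  q * P ^ suc h + q * P ^ suc h                          ≡⟨ cong₂ _+_ (flip q P (P ^ h)) (exch q P (P ^ h)) ⟩
  P ^ h * (q * P) + P * (q * P ^ h)                      ≤⟨ +-mono-≤ (*-monoʳ-≤ (P ^ h) le) (*-monoʳ-≤ P (power-mean h P f le)) ⟩
  P ^ h * sum f + P * sum (λ c → f c ^ h)                ≡⟨ cong₂ _+_ (*-distribˡ-sum (P ^ h) f) (*-distribˡ-sum P (λ c → f c ^ h)) ⟩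
  sum (λ c → P ^ h * f c) + sum (λ c → P * f c ^ h)      ≡⟨ ∑-distrib-+ (λ c → P ^ h * f c) (λ c → P * f c ^ h) ⟨
  sum (λ c → P ^ h * f c + P * f c ^ h)                  ≤⟨ sum-mono-≤ (λ c → power-chebyshev h (f c) P) ⟩
  sum (λ c → f c ^ suc h + P ^ suc h)                    ≡⟨ ∑-distrib-+ (λ c → f c ^ suc h) (λ _ → P ^ suc h) ⟩
  sum (λ c → f c ^ suc h) + sum {q} (λ _ → P ^ suc h)    ≡⟨ cong (sum (λ c → f c ^ suc h) +_) (sum-const q (P ^ suc h)) ⟩
  sum (λ c → f c ^ suc h) + q * P ^ suc h                ∎)
  where
  open ≤-Reasoning
  flip : ∀ q p z → q * (p * z) ≡ z * (q * p)
  flip = solve-∀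
  exch : ∀ q p z → q * (p * z) ≡ p * (q * z)
  exch = solve-∀

-- (1 - d / (P + d)) ^ k ≥ 1 - k d / (P + d), multiplied by (P + d) ^ suc k.
bernoulli : ∀ k P d → (P + d) ^ k * (P + d) ≤ P ^ k * (P + d) + k * d * (P + d) ^ k
bernoulli zero    P d = ≤-reflexive (sym (+-identityʳ _))
bernoulli (suc k) P d = begin
  (P + d) * (P + d) ^ k * (P + d)                              ≡⟨ *-assoc (P + d) _ _ ⟩
  (P + d) * ((P + d) ^ k * (P + d))                            ≤⟨ *-monoʳ-≤ (P + d) (bernoulli k P d) ⟩
  (P + d) * (P ^ k * (P + d) + k * d * (P + d) ^ k)            ≡⟨ expand P d (P ^ k) k ((P + d) ^ k) ⟩
  P * P ^ k * (P + d) + (d * (P + d) * P ^ k + k * d * ((P + d) * (P + d) ^ k))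
    ≤⟨ +-monoʳ-≤ (P * P ^ k * (P + d)) (+-monoˡ-≤ _ (*-monoʳ-≤ (d * (P + d)) (^-monoˡ-≤ k (m≤m+n P d)))) ⟩
  P * P ^ k * (P + d) + (d * (P + d) * (P + d) ^ k + k * d * ((P + d) * (P + d) ^ k))
    ≡⟨ cong (P * P ^ k * (P + d) +_) (collect d (P + d) ((P + d) ^ k) k) ⟩
  P * P ^ k * (P + d) + suc k * d * ((P + d) * (P + d) ^ k)    ∎
  where
  open ≤-Reasoning
  expand : ∀ P d x k y → (P + d) * (x * (P + d) + k * d * y) ≡ P * x * (P + d) + (d * (P + d) * x + k * d * ((P + d) * y))
  expand = solve-∀
  collect : ∀ d r y k → d * r * y + k * d * (r * y) ≡ suc k * d * (r * y)
  collect = solve-∀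

-- By `bernoulli`, (1 - d / (P + d)) ^ k is at least 1/2 once k d is at most half of P + d. In the
-- counts below `d` is the loss from the mean colour degree, which thus costs only a factor 2.
pow≤2*pow : ∀ k P d → 0 < P + d → 2 * (k * d) ≤ P + d → (P + d) ^ k ≤ 2 * P ^ k
pow≤2*pow k P d 0<ρ small = *-cancelʳ-≤ _ _ (P + d) {{>-nonZero 0<ρ}}
  (+-cancelʳ-≤ ((P + d) ^ k * (P + d)) _ _ (begin
  (P + d) ^ k * (P + d) + (P + d) ^ k * (P + d)      ≡⟨ double ((P + d) ^ k * (P + d)) ⟩
  2 * ((P + d) ^ k * (P + d))                        ≤⟨ *-monoʳ-≤ 2 (bernoulli k P d) ⟩
  2 * (P ^ k * (P + d) + k * d * (P + d) ^ k)        ≡⟨ expand (P ^ k) (P + d) (k * d) ((P + d) ^ k) ⟩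
  2 * P ^ k * (P + d) + (P + d) ^ k * (2 * (k * d))  ≤⟨ +-monoʳ-≤ (2 * P ^ k * (P + d)) (*-monoʳ-≤ ((P + d) ^ k) small) ⟩
  2 * P ^ k * (P + d) + (P + d) ^ k * (P + d)        ∎))
  where
  open ≤-Reasoning
  double : ∀ x → x + x ≡ 2 * x
  double = solve-∀
  expand : ∀ x r k y → 2 * (x * r + k * y) ≡ 2 * x * r + y * (2 * k)
  expand = solve-∀

*-^-distrib : ∀ k a b → (a * b) ^ k ≡ a ^ k * b ^ k
*-^-distrib zero    a b = refl
*-^-distrib (suc k) a b = trans (cong (a * b *_) (*-^-distrib k a b)) (shuffle a b (a ^ k) (b ^ k))
  where
  shuffle : ∀ a b x y → a * b * (x * y) ≡ a * x * (b * y)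
  shuffle = solve-∀

sum-∸ : ∀ h P (f : Fin q → ℕ) → q * (P + h) ≤ sum f → q * P ≤ sum (λ c → f c ∸ h)
sum-∸ {q} h P f le = +-cancelʳ-≤ (q * h) _ _ (begin
  q * P + q * h                              ≡⟨ *-distribˡ-+ q P h ⟨
  q * (P + h)                                ≤⟨ le ⟩
  sum f                                      ≤⟨ sum-mono-≤ (λ c → m≤n∸m+m (f c)) ⟩
  sum (λ c → f c ∸ h + h)                    ≡⟨ ∑-distrib-+ (λ c → f c ∸ h) (λ _ → h) ⟩
  sum (λ c → f c ∸ h) + sum {q} (λ _ → h)    ≡⟨ cong (sum (λ c → f c ∸ h) +_) (sum-const q h) ⟩
  sum (λ c → f c ∸ h) + q * h                ∎)
  where
  open ≤-Reasoning
  m≤n∸m+m : ∀ x → x ≤ x ∸ h + h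
  m≤n∸m+m x = ≤-trans (m≤n+m∸n x h) (≤-reflexive (+-comm h (x ∸ h)))

-- All terms except `r c` are bounded by `M`; the extra `M` on the left replaces a factor q - 1 on
-- the right.
sum+bound≤ : ∀ M (c : Fin q) (r : Fin q → ℕ) → (∀ d → r d ≤ M) → sum r + M ≤ r c + q * M
sum+bound≤ {suc q} M c r r≤M = begin
  sum r + M                              ≡⟨ cong (_+ M) (sum-remove {i = c} r) ⟩
  r c + sum (λ d → r (punchIn c d)) + M  ≤⟨ +-monoˡ-≤ M (+-monoʳ-≤ (r c) (sum-mono-≤ (λ d → r≤M (punchIn c d)))) ⟩
  r c + sum {q} (λ _ → M) + M            ≡⟨ cong (λ s → r c + s + M) (sum-const q M) ⟩
  r c + q * M + M                        ≡⟨ +-assoc (r c) _ M ⟩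
  r c + (q * M + M)                      ≡⟨ cong (r c +_) (+-comm (q * M) M) ⟩
  r c + suc q * M                        ∎
  where open ≤-Reasoning

pred-< : ∀ t → 0 < t → pred t < t
pred-< (suc t) _ = ≤-refl

-- Common neighbourhoods

hit : Fin q → Fin q → ℕ
hit c d = if does (c ≟ᶠ d) then 1 else 0

hit≤1 : (c d : Fin q) → hit c d ≤ 1
hit≤1 c d with c ≟ᶠ d
... | yes _ = ≤-refl
... | no  _ = z≤n

hit≢0⇒≡ : (c d : Fin q) → hit c d ≢ 0 → c ≡ d
hit≢0⇒≡ c d hit≢0 with c ≟ᶠ d
... | yes c≡d = c≡d
... | no  _   = ⊥-elim (hit≢0 refl)

sum-hit : (c : Fin q) → sum (hit c) ≡ 1
sum-hit {suc q} zero    = cong suc (trans (sum-const q 0) (*-zeroʳ q))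
sum-hit {suc q} (suc c) = trans (sum-cong-≗ hit-suc) (sum-hit c)
  where
  hit-suc : ∀ d → hit (suc c) (suc d) ≡ hit c d
  hit-suc d with c ≟ᶠ d
  ... | yes _ = refl
  ... | no  _ = refl

deg : (Fin m → Fin q) → Fin q → ℕ
deg χ c = sum λ y → hit (χ y) c

sum-deg : (χ : Fin m → Fin q) → sum (deg χ) ≡ m
sum-deg {m} χ = trans (sym (∑-comm λ y c → hit (χ y) c))
  (trans (sum-cong-≗ (λ y → sum-hit (χ y))) (trans (sum-const m 1) (*-identityʳ m)))

deg-remove : ∀ {h} (χ : Fin (suc m) → Fin q) (y : Fin (suc m)) (c : Fin q) →
             deg χ c ∸ suc h ≤ deg (χ ∘ punchIn y) c ∸ h
deg-remove {h = h} χ y c = ∸-monoˡ-≤ (suc h)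
  (≤-trans (≤-reflexive (sum-remove {i = y} (λ y → hit (χ y) c))) (+-monoˡ-≤ _ (hit≤1 (χ y) c)))

-- f is built one vertex at a time, by averaging the weight over the possible choices. Deleting the
-- chosen vertex keeps f injective and lowers every degree by at most one, whence deg ∸ h.
select : ∀ h {m} (χ : Fin n → Fin m → Fin q) (w : Fin h → Fin q) (ω e : Fin n → ℕ) T →
  (∀ v k → e v ≤ deg (χ v) (w k) ∸ h) → m ^ h * T < sum (λ v → ω v * e v ^ h) →
  Σ (Fin h → Fin m) λ f → Injective _≡_ _≡_ f × Σ (Fin n → ℕ) λ ω′ →
    T < sum ω′ × (∀ v → ω′ v ≤ ω v) × (∀ v → ω′ v ≢ 0 → ∀ k → χ v (f k) ≡ w k)
select zero χ w ω e T e≤ lt = (λ ()) , (λ {}) , ω ,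
  ≤-trans (≤-reflexive (cong suc (sym (+-identityʳ T)))) (≤-trans lt (≤-reflexive (sum-cong-≗ (λ v → *-identityʳ (ω v))))) ,
  (λ v → ≤-refl) , λ v _ ()
select {n} {q} (suc h) {m} χ w ω e T e≤ lt = extend (pigeonhole (m ^ h * T) weight heavy)
  where
  c = w zero

  weight : Fin m → ℕ
  weight y = sum λ v → ω v * hit (χ v y) c * e v ^ h

  -- Summed over `y`, the hits give the degree in colour `c`, which is at least `e v`: one factor
  -- `e v` of the power pays for the vertex chosen now.
  heavy : m * (m ^ h * T) < sum weight
  heavy = begin-strict
    m * (m ^ h * T)                                    ≡⟨ *-assoc m (m ^ h) T ⟨
    m ^ suc h * T                                      <⟨ lt ⟩
    sum (λ v → ω v * e v ^ suc h)                      ≤⟨ sum-mono-≤ (λ v → *-monoʳ-≤ (ω v) (*-monoˡ-≤ (e v ^ h)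
                                                            (≤-trans (e≤ v zero) (m∸n≤m (deg (χ v) c) (suc h))))) ⟩
    sum (λ v → ω v * (deg (χ v) c * e v ^ h))          ≡⟨ sum-cong-≗ (λ v → trans (rearrange (ω v) (deg (χ v) c) (e v ^ h))
                                                            (trans (*-distribˡ-sum (ω v * e v ^ h) (λ y → hit (χ v y) c))
                                                              (sum-cong-≗ λ y → swap (ω v) (e v ^ h) (hit (χ v y) c)))) ⟩
    sum (λ v → sum λ y → ω v * hit (χ v y) c * e v ^ h) ≡⟨ ∑-comm (λ v y → ω v * hit (χ v y) c * e v ^ h) ⟩
    sum weight                                         ∎
    where
    open ≤-Reasoning
    rearrange : ∀ x y z → x * (y * z) ≡ x * z * y
    rearrange = solve-∀
    swap : ∀ x y z → x * y * z ≡ x * z * y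
    swap = solve-∀

  extend : (∃ λ y → m ^ h * T < weight y) → _
  extend = go χ e≤
    where
    -- `m` is generalised again so that it can be matched as `suc m`; the vertex `y` rules out zero.
    go : ∀ {m} (χ : Fin n → Fin m → Fin q) → (∀ v k → e v ≤ deg (χ v) (w k) ∸ suc h) →
      (∃ λ y → m ^ h * T < sum (λ v → ω v * hit (χ v y) c * e v ^ h)) →
      Σ (Fin (suc h) → Fin m) λ f → Injective _≡_ _≡_ f × Σ (Fin n → ℕ) λ ω′ →
        T < sum ω′ × (∀ v → ω′ v ≤ ω v) × (∀ v → ω′ v ≢ 0 → ∀ k → χ v (f k) ≡ w k)
    go {suc m} χ e≤ (y , lt)
      with select h (λ v → χ v ∘ punchIn y) (w ∘ suc) (λ v → ω v * hit (χ v y) c) e T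
             (λ v k → ≤-trans (e≤ v (suc k)) (deg-remove (χ v) y (w (suc k))))
             (≤-<-trans (*-monoˡ-≤ T (^-monoˡ-≤ h (n≤1+n m))) lt)
    ... | f , f-inj , ω′ , T<ω′ , ω′≤ω , ω′-hit = f′ , f′-inj _ _ , ω′ , T<ω′ , ω′≤ , ω′-hit′
      where
      f′ : Fin (suc h) → Fin (suc m)
      f′ zero    = y
      f′ (suc k) = punchIn y (f k)
      f′-inj : ∀ i j → f′ i ≡ f′ j → i ≡ j
      f′-inj zero    zero    _  = refl
      f′-inj zero    (suc j) eq = contradiction (sym eq) (punchInᵢ≢i y (f j))
      f′-inj (suc i) zero    eq = contradiction eq (punchInᵢ≢i y (f i))
      f′-inj (suc i) (suc j) eq = cong suc (f-inj (punchIn-injective y _ _ eq))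
      ω′≤ : ∀ v → ω′ v ≤ ω v
      ω′≤ v = ≤-trans (ω′≤ω v) (≤-trans (*-monoʳ-≤ (ω v) (hit≤1 (χ v y) c)) (≤-reflexive (*-identityʳ (ω v))))
      ω′-hit′ : ∀ v → ω′ v ≢ 0 → ∀ k → χ v (f′ k) ≡ w k
      ω′-hit′ v ω′≢0 zero = hit≢0⇒≡ _ c λ hit≡0 → ω′≢0
        (n≤0⇒n≡0 (≤-trans (ω′≤ω v) (≤-reflexive (trans (cong (ω v *_) hit≡0) (*-zeroʳ (ω v))))))
      ω′-hit′ v ω′≢0 (suc k) = ω′-hit v ω′≢0 k

-- A constant word w yields a monochromatic complete bipartite graph; a word listing every colour a
-- times yields the a-sets S_c for all colours c at once.
common-neighbours : ∀ h T (χ : Fin n → Fin m → Fin q) (w : Fin h → Fin q) (e : Fin n → ℕ) →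
  (∀ v k → e v ≤ deg (χ v) (w k) ∸ h) → m ^ h * pred T < sum (λ v → e v ^ h) →
  Σ (Fin h → Fin m) λ f → Σ (Fin T → Fin n) λ g →
    Injective _≡_ _≡_ f × Injective _≡_ _≡_ g × (∀ i k → χ (g i) (f k) ≡ w k)
common-neighbours h T χ w e e≤ lt
  -- Starting from weights 1, the final weights are 0 or 1, so a total above `pred T` leaves at
  -- least `T` vertices.
  with select h χ w (λ _ → 1) e (pred T) e≤ (<-≤-trans lt (≤-reflexive (sum-cong-≗ λ v → sym (*-identityˡ (e v ^ h)))))
... | f , f-inj , ω , T<ω , ω≤1 , ω-hit with support T ω ω≤1 (≤-trans suc-pred-≤ T<ω)
  where
  suc-pred-≤ : ∀ {T} → T ≤ suc (pred T)
  suc-pred-≤ {zero}  = z≤n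
  suc-pred-≤ {suc _} = ≤-refl
...   | g , g-inj , g≢0 = f , g , f-inj , g-inj , λ i → ω-hit (g i) (g≢0 i)

-- After the sums over vertices and colours are interchanged, some single colour carries more than
-- `m ^ h * pred T`; its constant word is the one to select for.
common-neighbours-mono : ∀ h T (χ : Fin n → Fin m → Fin q) →
  q * (m ^ h * pred T) < sum (λ v → sum λ c → (deg (χ v) c ∸ h) ^ h) →
  Σ (Fin q) λ c → Σ (Fin h → Fin m) λ f → Σ (Fin T → Fin n) λ g →
    Injective _≡_ _≡_ f × Injective _≡_ _≡_ g × (∀ i k → χ (g i) (f k) ≡ c)
common-neighbours-mono h T χ lt
  with pigeonhole _ _ (<-≤-trans lt (≤-reflexive (∑-comm λ v c → (deg (χ v) c ∸ h) ^ h)))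
... | c , lt′ = c , common-neighbours h T χ (λ _ → c) (λ v → deg (χ v) c ∸ h) (λ _ _ → ≤-refl) lt′

-- Drawing complete bipartite graphs

-- All vertices from K on are fresh.
Bounded : ℕ → Board q → Set
Bounded K B = ∀ {x y c} → edge x y c ∈ B → x < K × y < K

mono-wins : ∀ {t} k {B : Board q} → HasMonoKtt t B → BuilderWinsIn q t k B
mono-wins zero    mono = mono
mono-wins (suc k) mono = inj₁ mono

-- Builder's play in continuation form: `win` answers every board that Painter's choices can
-- produce. Once the star is begun `K` is no longer fresh, so the newness of the remaining edges is
-- carried as a separate hypothesis.
draw-star : ∀ {t} n {k K} {B : Board q} (x : Fin n → ℕ) → Injective _≡_ _≡_ x → (∀ i → x i < K) →
  (∀ i c → ¬ HasEdge B (x i) K c) → Bounded (suc K) B →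
  (∀ B′ (χ : Fin n → Fin q) → B ⊆ B′ → Bounded (suc K) B′ →
    (∀ i → edge (x i) K (χ i) ∈ B′) → BuilderWinsIn q t k B′) →
  BuilderWinsIn q t (n + k) B
draw-star zero    {B = B} x x-inj x<K new bnd win = win B (λ ()) id bnd λ ()
draw-star {q} {t} (suc n) {k} {K} {B} x x-inj x<K new bnd win =
  inj₂ (x zero , K , (<⇒≢ (x<K zero) , new zero) , λ c →
    draw-star n (x ∘ suc) (suc-injective ∘ x-inj) (x<K ∘ suc) (new′ c) (bnd′ c) λ B′ χ B⊆B′ bnd″ χ∈B′ →
      win B′ (λ { zero → c ; (suc i) → χ i }) (B⊆B′ ∘ there) bnd″
        λ { zero → B⊆B′ (here refl) ; (suc i) → χ∈B′ i })
  where
  new′ : ∀ c i d → ¬ HasEdge (edge (x zero) K c ∷ B) (x (suc i)) K d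
  new′ c i d (inj₁ (here eq)) with () ← x-inj (cong CEdge.u eq)
  new′ c i d (inj₂ (here eq)) = <⇒≢ (x<K zero) (sym (cong CEdge.u eq))
  new′ c i d (inj₁ (there e)) = new (suc i) d (inj₁ e)
  new′ c i d (inj₂ (there e)) = new (suc i) d (inj₂ e)
  bnd′ : ∀ c → Bounded (suc K) (edge (x zero) K c ∷ B)
  bnd′ c (here refl) = m<n⇒m<1+n (x<K zero) , ≤-refl
  bnd′ c (there e)   = bnd e

-- The new vertices are K, ..., K + m - 1, each the centre of one star; each is fresh when its star
-- begins.
draw-grid : ∀ {t} m {k K} {B : Board q} (x : Fin n → ℕ) → Injective _≡_ _≡_ x → (∀ i → x i < K) → Bounded K B →
  (∀ B′ (χ : Fin n → Fin m → Fin q) → B ⊆ B′ → Bounded (m + K) B′ →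
    (∀ i j → edge (x i) (toℕ j + K) (χ i j) ∈ B′) → BuilderWinsIn q t k B′) →
  BuilderWinsIn q t (m * n + k) B
draw-grid zero {B = B} x x-inj x<K bnd win = win B (λ _ ()) id bnd λ _ ()
draw-grid {q} {n} {t} (suc m) {k} {K} {B} x x-inj x<K bnd win =
  subst (λ N → BuilderWinsIn q t N B) (sym (+-assoc n (m * n) k))
    (draw-star n x x-inj x<K
      (λ { i c (inj₁ e) → <-irrefl refl (proj₂ (bnd e)) ; i c (inj₂ e) → <-irrefl refl (proj₁ (bnd e)) })
      (λ e → m<n⇒m<1+n (proj₁ (bnd e)) , m<n⇒m<1+n (proj₂ (bnd e)))
      λ B₁ χ₁ B⊆B₁ bnd₁ χ₁∈B₁ → draw-grid m x x-inj (m<n⇒m<1+n ∘ x<K) bnd₁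
        λ B₂ χ₂ B₁⊆B₂ bnd₂ χ₂∈B₂ →
          win B₂ (λ { i zero → χ₁ i ; i (suc j) → χ₂ i j }) (B₁⊆B₂ ∘ B⊆B₁)
            (subst (λ M → Bounded M B₂) (+-suc m K) bnd₂)
            λ { i zero    → B₁⊆B₂ (χ₁∈B₁ i)
              ; i (suc j) → subst (λ y → edge (x i) y (χ₂ i j) ∈ B₂) (+-suc (toℕ j) K) (χ₂∈B₂ i j) })

-- The colour `c` is known only after the new edges are coloured, so a set `s c` is kept ready for
-- every colour. It supplies `a` vertices of one side, and only `h` new ones have to be found.
complete-to-mono : ∀ a h {K} {B : Board q} (x : Fin n → ℕ) (s : Fin q → Fin a → ℕ) →
  (∀ (χ : Fin n → Fin m → Fin q) → q * (m ^ h * pred (a + h)) < sum (λ v → sum λ c → (deg (χ v) c ∸ h) ^ h)) →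
  Injective _≡_ _≡_ x → (∀ i → x i < K) → (∀ c → Injective _≡_ _≡_ (s c)) → (∀ c k → s c k < K) →
  (∀ i c k → x i ≢ s c k) → (∀ i c k → edge (x i) (s c k) c ∈ B) → Bounded K B →
  BuilderWinsIn q (a + h) (m * n) B
complete-to-mono {q} {n} {m} a h {K} {B} x s many x-inj x<K s-inj s<K x≢s s∈B bnd =
  subst (λ N → BuilderWinsIn q (a + h) N B) (+-identityʳ (m * n)) (draw-grid m {k = 0} x x-inj x<K bnd finish)
  where
  finish : ∀ B′ (χ : Fin n → Fin m → Fin q) → B ⊆ B′ → Bounded (m + K) B′ →
    (∀ i j → edge (x i) (toℕ j + K) (χ i j) ∈ B′) → HasMonoKtt (a + h) B′
  finish B′ χ B⊆B′ _ χ∈B′ with common-neighbours-mono h (a + h) χ (many χ)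
  ... | c , f , g , f-inj , g-inj , χ≡c =
    c , x ∘ g , y ∘ splitAt a , g-inj ∘ x-inj , inj , (λ i j → disj i (splitAt a j)) , λ i j → edges i (splitAt a j)
    where
    y : Fin a ⊎ Fin h → ℕ
    y = [ s c , (λ k → toℕ (f k) + K) ]′
    s≢f : ∀ i k → s c i ≢ toℕ (f k) + K
    s≢f i k = <⇒≢ (<-≤-trans (s<K c i) (m≤n+m K _))
    y-inj : ∀ u v → y u ≡ y v → u ≡ v
    y-inj (inj₁ i) (inj₁ j) eq = cong inj₁ (s-inj c eq)
    y-inj (inj₁ i) (inj₂ j) eq = ⊥-elim (s≢f i j eq)
    y-inj (inj₂ i) (inj₁ j) eq = ⊥-elim (s≢f j i (sym eq))
    y-inj (inj₂ i) (inj₂ j) eq = cong inj₂ (f-inj (toℕ-injective (+-cancelʳ-≡ K _ _ eq)))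
    inj : Injective _≡_ _≡_ (y ∘ splitAt a)
    inj {i} {j} eq = trans (sym (join-splitAt a h i)) (trans (cong (join a h) (y-inj (splitAt a i) (splitAt a j) eq)) (join-splitAt a h j))
    disj : ∀ i u → x (g i) ≢ y u
    disj i (inj₁ k) = x≢s (g i) c k
    disj i (inj₂ k) = <⇒≢ (<-≤-trans (x<K (g i)) (m≤n+m K _))
    edges : ∀ i u → HasEdge B′ (x (g i)) (y u) c
    edges i (inj₁ k) = inj₁ (B⊆B′ (s∈B (g i) c k))
    edges i (inj₂ k) = inj₁ (subst (λ d → edge (x (g i)) (toℕ (f k) + K) d ∈ B′) (χ≡c i k) (χ∈B′ (g i) (f k)))

-- Counting conditions of the two stages

-- The colour degrees at a vertex have mean P + h; subtracting `h` leaves mean at least `P`, to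
-- which `power-mean` applies. The factor 2 in `n` pays for replacing (P + h) ^ h by P ^ h.
second-stage-count : ∀ h t P → 0 < t → 0 < q → 0 < P + h → 2 * (h * h) ≤ P + h → n ≡ 2 * q ^ h * t → m ≡ q * (P + h) →
  (χ : Fin n → Fin m → Fin q) → q * (m ^ h * pred t) < sum (λ v → sum λ c → (deg (χ v) c ∸ h) ^ h)
second-stage-count {q} {n} {m} h t P 0<t 0<q 0<ρ small n≡ m≡ χ = begin-strict
  q * (m ^ h * pred t)            <⟨ *-monoʳ-< q {{>-nonZero 0<q}} (*-monoʳ-< (m ^ h) {{m^n≢0 m h {{>-nonZero 0<m}}}} (pred-< t 0<t)) ⟩
  q * (m ^ h * t)                 ≡⟨ cong (λ z → q * (z ^ h * t)) m≡ ⟩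
  q * ((q * ρ) ^ h * t)           ≡⟨ cong (λ z → q * (z * t)) (*-^-distrib h q ρ) ⟩
  q * (q ^ h * ρ ^ h * t)         ≤⟨ *-monoʳ-≤ q (*-monoˡ-≤ t (*-monoʳ-≤ (q ^ h) (pow≤2*pow h P h 0<ρ small))) ⟩
  q * (q ^ h * (2 * P ^ h) * t)   ≡⟨ shuffle q (q ^ h) (P ^ h) t ⟩
  2 * q ^ h * t * (q * P ^ h)     ≡⟨ cong (_* (q * P ^ h)) n≡ ⟨
  n * (q * P ^ h)                 ≡⟨ sum-const n _ ⟨
  sum {n} (λ _ → q * P ^ h)       ≤⟨ sum-mono-≤ (λ v → power-mean h P (λ c → deg (χ v) c ∸ h)
                                       (sum-∸ h P (deg (χ v)) (≤-reflexive (trans (sym m≡) (sym (sum-deg (χ v))))))) ⟩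
  sum (λ v → sum λ c → (deg (χ v) c ∸ h) ^ h) ∎
  where
  open ≤-Reasoning
  ρ = P + h
  0<m : 0 < m
  0<m = subst (0 <_) (sym m≡) (*-mono-≤ 0<q 0<ρ)
  shuffle : ∀ q x y t → q * (x * (2 * y) * t) ≡ 2 * x * t * (q * y)
  shuffle = solve-∀

-- With ρ = P + q t, if all colour degrees are below ρ + t, then each is at least q ρ - (q - 1) (ρ +
-- t) = P + t.
rich-or-balanced : ∀ t l P (r : Fin q → ℕ) → l ≤ t → sum r ≡ q * (P + q * t) →
  (P + q * t) ^ t ≤ sum (λ c → (r c ∸ t) ^ t) ⊎ (∀ c → P ≤ r c ∸ l)
rich-or-balanced {q} t l P r l≤t Σr≡ with any? (λ c → P + q * t + t ≤? r c)
... | yes (c , rich) = inj₁ (≤-trans (^-monoˡ-≤ t (m+n≤o⇒m≤o∸n (P + q * t) rich)) (term≤sum (λ c → (r c ∸ t) ^ t) c))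
... | no ¬rich = inj₂ λ c → m+n≤o⇒m≤o∸n P (≤-trans (+-monoʳ-≤ P l≤t) (+-cancelʳ-≤ (q * ρ + q * t) _ _ (begin
  P + t + (q * ρ + q * t)      ≡⟨ regroup P t (q * ρ) (q * t) ⟩
  q * ρ + (P + q * t + t)      ≡⟨ cong (_+ (ρ + t)) (sym Σr≡) ⟩
  sum r + (ρ + t)              ≤⟨ sum+bound≤ (ρ + t) c r (λ c → ≰⇒≥ (λ rich → ¬rich (c , rich))) ⟩
  r c + q * (ρ + t)            ≡⟨ cong (r c +_) (*-distribˡ-+ q ρ t) ⟩
  r c + (q * ρ + q * t)        ∎)))
  where
  open ≤-Reasoning
  ρ = P + q * t
  regroup : ∀ P t x y → P + t + (x + y) ≡ x + (P + y + t)
  regroup = solve-∀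

-- The two summands of `n` are numbers of rich and of balanced vertices that suffice for the
-- respective alternative; `pigeonhole₂` finds enough of one kind.
first-stage-count : ∀ l t P N → 0 < t → 0 < q → 0 < N → l ≤ t → 0 < P + q * t → 2 * (l * (q * t)) ≤ P + q * t →
  n ≡ q * q ^ t * t + 2 * q ^ l * N → m ≡ q * (P + q * t) → (χ : Fin n → Fin m → Fin q) →
  q * (m ^ t * pred t) < sum (λ v → sum λ c → (deg (χ v) c ∸ t) ^ t) ⊎
  Σ (Fin n → ℕ) λ e → (∀ v c → e v ≤ deg (χ v) c ∸ l) × m ^ l * pred N < sum (λ v → e v ^ l)
first-stage-count {q} {n} {m} l t P N 0<t 0<q 0<N l≤t 0<ρ small n≡ m≡ χ =
  conclude (pigeonhole₂ (q * q ^ t * t) (2 * q ^ l * N) rich (λ v → e v ^ l) (≤-reflexive (sym n≡))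
    (λ v → proj₂ (proj₂ (choice v))))
  where
  open ≤-Reasoning
  ρ = P + q * t
  0<m : 0 < m
  0<m = subst (0 <_) (sym m≡) (*-mono-≤ 0<q 0<ρ)

  rich : Fin n → ℕ
  rich v = sum λ c → (deg (χ v) c ∸ t) ^ t

  choice : ∀ v → Σ ℕ λ e → (∀ c → e ≤ deg (χ v) c ∸ l) × (ρ ^ t ≤ rich v ⊎ P ^ l ≤ e ^ l)
  choice v with rich-or-balanced t l P (deg (χ v)) l≤t (trans (sum-deg (χ v)) m≡)
  -- The default 0 lies below every truncated degree; a rich vertex is counted through its power sum
  -- instead.
  ... | inj₁ r = 0 , (λ _ → z≤n) , inj₁ r
  ... | inj₂ b = P , b , inj₂ ≤-refl

  e : Fin n → ℕ
  e v = proj₁ (choice v)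

  m^k≡ : ∀ k → m ^ k ≡ q ^ k * ρ ^ k
  m^k≡ k = trans (cong (_^ k) m≡) (*-^-distrib k q ρ)

  m^k*pred< : ∀ k {T} → 0 < T → m ^ k * pred T < m ^ k * T
  m^k*pred< k 0<T = *-monoʳ-< (m ^ k) {{m^n≢0 m k {{>-nonZero 0<m}}}} (pred-< _ 0<T)

  conclude : q * q ^ t * t * ρ ^ t ≤ sum rich ⊎ 2 * q ^ l * N * P ^ l ≤ sum (λ v → e v ^ l) → _
  conclude (inj₁ le) = inj₁ (begin-strict
    q * (m ^ t * pred t)       <⟨ *-monoʳ-< q {{>-nonZero 0<q}} (m^k*pred< t 0<t) ⟩
    q * (m ^ t * t)            ≡⟨ cong (λ z → q * (z * t)) (m^k≡ t) ⟩
    q * (q ^ t * ρ ^ t * t)    ≡⟨ shuffle q (q ^ t) (ρ ^ t) t ⟩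
    q * q ^ t * t * ρ ^ t      ≤⟨ le ⟩
    sum rich                   ∎)
    where
    shuffle : ∀ q x y t → q * (x * y * t) ≡ q * x * t * y
    shuffle = solve-∀
  conclude (inj₂ le) = inj₂ (e , (λ v → proj₁ (proj₂ (choice v))) , (begin-strict
    m ^ l * pred N             <⟨ m^k*pred< l 0<N ⟩
    m ^ l * N                  ≡⟨ cong (_* N) (m^k≡ l) ⟩
    q ^ l * ρ ^ l * N          ≤⟨ *-monoˡ-≤ N (*-monoʳ-≤ (q ^ l) (pow≤2*pow l P (q * t) 0<ρ small)) ⟩
    q ^ l * (2 * P ^ l) * N    ≡⟨ shuffle (q ^ l) (P ^ l) N ⟩
    2 * q ^ l * N * P ^ l      ≤⟨ le ⟩
    sum (λ v → e v ^ l)        ∎))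
    where
    shuffle : ∀ x y t → x * (2 * y) * t ≡ 2 * x * t * y
    shuffle = solve-∀

-- The mean colour degree is `2 * (t * t)`, which meets the smallness condition for every `h ≤ t`.
second-stage-suffices : ∀ {q n m} h t → h ≤ t → 0 < t → 0 < q → n ≡ 2 * q ^ h * t → m ≡ q * (2 * (t * t)) →
  (χ : Fin n → Fin m → Fin q) → q * (m ^ h * pred t) < sum (λ v → sum λ c → (deg (χ v) c ∸ h) ^ h)
second-stage-suffices {q} h t h≤t 0<t 0<q n≡ m≡ = second-stage-count h t (2 * (t * t) ∸ h) 0<t 0<q
  (subst (0 <_) (sym ρ≡) (<-≤-trans 0<t t≤ρ)) (≤-trans (*-monoʳ-≤ 2 (*-mono-≤ h≤t h≤t)) (≤-reflexive (sym ρ≡)))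
  n≡ (trans m≡ (cong (q *_) (sym ρ≡)))
  where
  t≤ρ : t ≤ 2 * (t * t)
  t≤ρ = ≤-trans (m≤m*n t t {{>-nonZero 0<t}}) (m≤n*m (t * t) 2)
  ρ≡ : 2 * (t * t) ∸ h + h ≡ 2 * (t * t)
  ρ≡ = m∸n+n≡m (≤-trans h≤t t≤ρ)

-- The mean colour degree `ρ` is chosen to give equality in the smallness condition of
-- `first-stage-count`.
first-stage-suffices : ∀ {q n m} l t N → 0 < l → l ≤ t → 0 < t → 0 < q → 0 < N →
  n ≡ q * q ^ t * t + 2 * q ^ l * N → m ≡ q * (2 * (l * (q * t))) → (χ : Fin n → Fin m → Fin q) →
  q * (m ^ t * pred t) < sum (λ v → sum λ c → (deg (χ v) c ∸ t) ^ t) ⊎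
  Σ (Fin n → ℕ) λ e → (∀ v c → e v ≤ deg (χ v) c ∸ l) × m ^ l * pred N < sum (λ v → e v ^ l)
first-stage-suffices {q} l t N 0<l l≤t 0<t 0<q 0<N n≡ m≡ = first-stage-count l t (ρ ∸ q * t) N 0<t 0<q 0<N l≤t
  (subst (0 <_) (sym ρ≡) (<-≤-trans (*-mono-≤ 0<q 0<t) qt≤ρ)) (≤-reflexive (sym ρ≡)) n≡ (trans m≡ (cong (q *_) (sym ρ≡)))
  where
  ρ = 2 * (l * (q * t))
  qt≤ρ : q * t ≤ ρ
  qt≤ρ = ≤-trans (m≤n*m (q * t) l {{>-nonZero 0<l}}) (m≤n*m (l * (q * t)) 2)
  ρ≡ : ρ ∸ q * t + q * t ≡ ρ
  ρ≡ = m∸n+n≡m qt≤ρ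

-- Builder's strategies

two-stage : ∀ a h {t n₁ m₁ n₂ m₂} → a + h ≡ t →
  (∀ (χ : Fin n₁ → Fin m₁ → Fin q) →
    q * (m₁ ^ t * pred t) < sum (λ v → sum λ c → (deg (χ v) c ∸ t) ^ t) ⊎
    Σ (Fin n₁ → ℕ) λ e → (∀ v c → e v ≤ deg (χ v) c ∸ q * a) × m₁ ^ (q * a) * pred n₂ < sum (λ v → e v ^ (q * a))) →
  (∀ (χ : Fin n₂ → Fin m₂ → Fin q) → q * (m₂ ^ h * pred t) < sum (λ v → sum λ c → (deg (χ v) c ∸ h) ^ h)) →
  BuilderWinsIn q t (m₁ * n₁ + m₂ * n₂) []
two-stage {q} a h {_} {n₁} {m₁} {n₂} {m₂} refl count₁ count₂ =
  draw-grid m₁ {K = n₁} toℕ toℕ-injective toℕ<n (λ ()) continue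
  where
  y : Fin m₁ → ℕ
  y j = toℕ j + n₁
  y-inj : Injective _≡_ _≡_ y
  y-inj = toℕ-injective ∘ +-cancelʳ-≡ n₁ _ _
  x≢y : ∀ (i : Fin n₁) j → toℕ i ≢ y j
  x≢y i j = <⇒≢ (<-≤-trans (toℕ<n i) (m≤n+m n₁ (toℕ j)))

  continue : ∀ B (χ : Fin n₁ → Fin m₁ → Fin q) → [] ⊆ B → Bounded (m₁ + n₁) B →
    (∀ i j → edge (toℕ i) (y j) (χ i j) ∈ B) → BuilderWinsIn q (a + h) (m₂ * n₂) B
  continue B χ _ bnd χ∈B with count₁ χ
  ... | inj₁ rich with common-neighbours-mono (a + h) (a + h) χ rich
  ...   | c , f , g , f-inj , g-inj , χ≡c =
    mono-wins (m₂ * n₂) (c , toℕ ∘ g , y ∘ f , g-inj ∘ toℕ-injective , f-inj ∘ y-inj , (λ i j → x≢y (g i) (f j)) ,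
      λ i j → inj₁ (subst (λ d → edge (toℕ (g i)) (y (f j)) d ∈ B) (χ≡c i j) (χ∈B (g i) (f j))))
  continue B χ _ bnd χ∈B | inj₂ (e , e≤ , balanced)
    -- `quotient a` is the word made of one block of length `a` per colour; the positions
    -- `combine c k` form block `c` and yield S_c.
    with common-neighbours (q * a) n₂ χ (quotient a) e (λ v k → e≤ v (quotient a k)) balanced
  ... | f , g , f-inj , g-inj , χ≡w =
    complete-to-mono {m = m₂} a h (toℕ ∘ g) (λ c k → y (f (combine c k))) count₂ (g-inj ∘ toℕ-injective)
      (λ i → <-≤-trans (toℕ<n (g i)) (m≤n+m n₁ m₁))
      (λ c eq → combine-injectiveʳ c _ c _ (f-inj (y-inj eq)))
      (λ c k → +-monoˡ-< n₁ (toℕ<n (f (combine c k))))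
      (λ i c k → x≢y (g i) _)
      (λ i c k → subst (λ d → edge (toℕ (g i)) (y (f (combine c k))) d ∈ B)
        (trans (χ≡w i (combine c k)) (cong proj₁ (remQuot-combine c k))) (χ∈B (g i) (f (combine c k))))
      bnd

-- The second stage alone, with empty sets S_c; it serves the case where `depth` returns 0.
one-stage : ∀ h → (∀ (χ : Fin n → Fin m → Fin q) → q * (m ^ h * pred h) < sum (λ v → sum λ c → (deg (χ v) c ∸ h) ^ h)) →
  BuilderWinsIn q h (m * n) []
one-stage {n} {m} h count = complete-to-mono {n = n} {m = m} 0 h toℕ (λ _ ()) count toℕ-injective toℕ<n
  (λ { _ {()} }) (λ _ ()) (λ _ _ ()) (λ _ _ ()) (λ ())

-- The choice of a and the number of edges

-- The search runs down from `n`, so the first success met has a failure directly above it.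
last-true : ∀ {P : ℕ → Set} → (∀ n → Dec (P n)) → ∀ n → P 0 → ¬ P n → Σ ℕ λ a → P a × ¬ P (suc a)
last-true P? zero    p0 ¬pn = contradiction p0 ¬pn
last-true P? (suc n) p0 ¬pn with P? n
... | yes pn  = n , pn , ¬pn
... | no  ¬pn′ = last-true P? n p0 ¬pn′

n<b^n : ∀ {b} → 2 ≤ b → ∀ n → n < b ^ n
n<b^n 2≤b zero    = s≤s z≤n
n<b^n {b} 2≤b (suc n) = begin-strict
  suc n        <⟨ +-monoʳ-≤ 1 (n<b^n 2≤b n) ⟩
  1 + b ^ n    ≤⟨ +-monoˡ-≤ (b ^ n) (≤-trans (s≤s z≤n) (n<b^n 2≤b n)) ⟩
  b ^ n + b ^ n ≡⟨ cong (b ^ n +_) (sym (+-identityʳ (b ^ n))) ⟩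
  2 * b ^ n    ≤⟨ *-monoˡ-≤ (b ^ n) 2≤b ⟩
  b ^ suc n    ∎
  where open ≤-Reasoning

^-cancelˡ-≤ : ∀ b → 1 < b → ∀ {x y} → b ^ x ≤ b ^ y → x ≤ y
^-cancelˡ-≤ b 1<b le = ≮⇒≥ λ y<x → <⇒≱ (^-monoʳ-< b 1<b y<x) le

module Parameters {q t : ℕ} (2≤q : 2 ≤ q) (2≤t : 2 ≤ t) where

  private instance
    q≢0 : NonZero q
    q≢0 = >-nonZero (≤-trans (s≤s z≤n) 2≤q)
    t≢0 : NonZero t
    t≢0 = >-nonZero (≤-trans (s≤s z≤n) 2≤t)

  q^t≤2^[q*t] : q ^ t ≤ 2 ^ (q * t)
  q^t≤2^[q*t] = ≤-trans (^-monoˡ-≤ t (<⇒≤ (n<b^n ≤-refl q))) (≤-reflexive (^-*-assoc 2 q t))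

  -- Both bases are compared with 2, using q < 2 ^ q. This crude bound starts the search for `a`
  -- with a failure and gives `q ≤ t` when `a` is positive.
  exponent≤q*t : ∀ x → t ^ x ≤ q ^ t → x ≤ q * t
  exponent≤q*t x le = ^-cancelˡ-≤ 2 ≤-refl (≤-trans (^-monoˡ-≤ x 2≤t) (≤-trans le q^t≤2^[q*t]))

  -- Since q ^ (q a) ≤ t / log_q t < q ^ (q (a + 1)), the first inequality bounds the cost of the
  -- first stage and the second one that of the second stage.
  depth : Σ ℕ λ a → t ^ (q ^ (q * a)) ≤ q ^ t × q ^ t < t ^ (q ^ (q * suc a))
  depth with last-true (λ a → t ^ (q ^ (q * a)) ≤? q ^ t) t start stop
    where
    start : t ^ (q ^ (q * 0)) ≤ q ^ t
    start = subst (λ z → t ^ (q ^ z) ≤ q ^ t) (sym (*-zeroʳ q))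
      (≤-trans (≤-reflexive (^-identityʳ t)) (<⇒≤ (n<b^n 2≤q t)))
    stop : ¬ t ^ (q ^ (q * t)) ≤ q ^ t
    stop le = <⇒≱ (n<b^n 2≤q (q * t)) (exponent≤q*t _ le)
  ... | a , le , ¬le = a , le , ≰⇒> ¬le

  q^[q*a]≤t : ∀ {a} → 0 < a → t ^ (q ^ (q * a)) ≤ q ^ t → q ^ (q * a) ≤ t
  q^[q*a]≤t {a} 0<a le = ^-cancelˡ-≤ q 2≤q (≤-trans (^-monoˡ-≤ (q ^ (q * a)) q≤t) le)
    where
    -- Positivity of `a` enters here: q a ≥ 2, so q ^ 2 ≤ q ^ (q a) ≤ q t.
    q≤t : q ≤ t
    q≤t = *-cancelˡ-≤ q (begin
      q * q          ≡⟨ cong (q *_) (sym (^-identityʳ q)) ⟩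
      q ^ 2          ≤⟨ ^-monoʳ-≤ q (≤-trans 2≤q (m≤m*n q a {{>-nonZero 0<a}})) ⟩
      q ^ (q * a)    ≤⟨ exponent≤q*t _ le ⟩
      q * t          ∎)
      where open ≤-Reasoning

  -- A bootstrap: lowering the base `t` to q ^ (q a) by the previous bound gains the factor q a in
  -- the exponent.
  [q*a]*q^[q*a]≤t : ∀ {a} → 0 < a → t ^ (q ^ (q * a)) ≤ q ^ t → q * a * q ^ (q * a) ≤ t
  [q*a]*q^[q*a]≤t {a} 0<a le = ^-cancelˡ-≤ q 2≤q (begin
    q ^ (q * a * q ^ (q * a))      ≡⟨ ^-*-assoc q (q * a) (q ^ (q * a)) ⟨
    (q ^ (q * a)) ^ (q ^ (q * a))  ≤⟨ ^-monoˡ-≤ (q ^ (q * a)) (q^[q*a]≤t 0<a le) ⟩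
    t ^ (q ^ (q * a))              ≤⟨ le ⟩
    q ^ t                          ∎)
    where open ≤-Reasoning

  -- Raising N ≤ C q^(t+2) t^(3-1/q) (log_q t)^(1/q) to the power q and exponentiating in base q
  -- removes the root and the logarithm: `q ^ (N ^ q) ≤ t ^ (C ^ q * Z * t ^ w)`. It is shown for
  -- twice the cost of each stage, as `double-bound` requires.
  module Bounds {C : ℕ} {a h : ℕ} (t≡ : a + h ≡ t) where

    private
      w = 3 * q ∸ 1
      Z = q ^ (q * (t + 2))

      suc-w : suc w ≡ 3 * q
      suc-w = trans (+-comm 1 w) (m∸n+n≡m (≤-trans (≤-trans (s≤s z≤n) 2≤q) (m≤n*m q 3)))

    N₁ N₂ : ℕ
    N₂ = q * (2 * (t * t)) * (2 * q ^ h * t)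
    N₁ = q * (2 * (q * a * (q * t))) * (q * q ^ t * t + 2 * q ^ (q * a) * (2 * q ^ h * t))

    -- Here 2 N₂ = 8 q^(h+1) t^3. One factor t of its q-th power is spent on forming q ^ t, which
    -- the choice of `a` bounds by a power of t; the exponents of q add up to q (a + 1) + q (h + 1)
    -- = q (t + 2).
    N₂-bound : 8 ≤ C → q ^ t < t ^ (q ^ (q * suc a)) → q ^ ((2 * N₂) ^ q) ≤ t ^ (C ^ q * Z * t ^ w)
    N₂-bound 8≤C q^t< = begin
      q ^ ((2 * N₂) ^ q)           ≡⟨ cong (q ^_) 2N₂^q≡ ⟩
      q ^ (t * Y)                  ≡⟨ ^-*-assoc q t Y ⟨
      (q ^ t) ^ Y                  ≤⟨ ^-monoˡ-≤ Y (<⇒≤ q^t<) ⟩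
      (t ^ (q ^ (q * suc a))) ^ Y  ≡⟨ ^-*-assoc t (q ^ (q * suc a)) Y ⟩
      t ^ (q ^ (q * suc a) * Y)    ≤⟨ ^-monoʳ-≤ t exponent ⟩
      t ^ (C ^ q * Z * t ^ w)      ∎
      where
      open ≤-Reasoning
      Q = (q ^ suc h) ^ q
      Y = 8 ^ q * Q * t ^ w

      expand : ∀ q t x → 2 * (q * (2 * (t * t)) * (2 * x * t)) ≡ 8 * (q * x) * (t * (t * t))
      expand = solve-∀
      shuffle : ∀ t x y → x * (t * y) ≡ t * (x * y)
      shuffle = solve-∀
      rearr : ∀ x y z u → x * (y * z * u) ≡ y * (x * z) * u
      rearr = solve-∀
      lin : ∀ q a h → q * suc a + suc h * q ≡ q * (a + h + 2)
      lin = solve-∀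
      three : ∀ q → q + (q + q) ≡ 3 * q
      three = solve-∀

      2N₂^q≡ : (2 * N₂) ^ q ≡ t * Y
      2N₂^q≡ = begin-equality
        (2 * N₂) ^ q                                  ≡⟨ cong (_^ q) (expand q t (q ^ h)) ⟩
        (8 * q ^ suc h * (t * (t * t))) ^ q           ≡⟨ *-^-distrib q (8 * q ^ suc h) (t * (t * t)) ⟩
        (8 * q ^ suc h) ^ q * (t * (t * t)) ^ q       ≡⟨ cong₂ _*_ (*-^-distrib q 8 (q ^ suc h))
                                                           (trans (*-^-distrib q t (t * t)) (cong (t ^ q *_) (*-^-distrib q t t))) ⟩
        8 ^ q * Q * (t ^ q * (t ^ q * t ^ q))         ≡⟨ cong (8 ^ q * Q *_) (trans (cong (t ^ q *_) (sym (^-distribˡ-+-* t q q)))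
                                                           (sym (^-distribˡ-+-* t q (q + q)))) ⟩
        8 ^ q * Q * t ^ (q + (q + q))                 ≡⟨ cong (λ z → 8 ^ q * Q * t ^ z) (trans (three q) (sym suc-w)) ⟩
        8 ^ q * Q * (t * t ^ w)                       ≡⟨ shuffle t (8 ^ q * Q) (t ^ w) ⟩
        t * Y                                         ∎

      exponent : q ^ (q * suc a) * Y ≤ C ^ q * Z * t ^ w
      exponent = begin
        q ^ (q * suc a) * (8 ^ q * Q * t ^ w)         ≡⟨ rearr (q ^ (q * suc a)) (8 ^ q) Q (t ^ w) ⟩
        8 ^ q * (q ^ (q * suc a) * Q) * t ^ w         ≡⟨ cong (λ z → 8 ^ q * z * t ^ w) (trans (cong (q ^ (q * suc a) *_) (^-*-assoc q (suc h) q))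
                                                           (sym (^-distribˡ-+-* q (q * suc a) (suc h * q)))) ⟩
        8 ^ q * q ^ (q * suc a + suc h * q) * t ^ w   ≡⟨ cong (λ z → 8 ^ q * q ^ z * t ^ w) (trans (lin q a h) (cong (λ z → q * (z + 2)) t≡)) ⟩
        8 ^ q * Z * t ^ w                             ≤⟨ *-monoˡ-≤ (t ^ w) (*-monoˡ-≤ Z (^-monoˡ-≤ q 8≤C)) ⟩
        C ^ q * Z * t ^ w                             ∎

    -- Here 2 N₁ is at most 20 q^(t+2) t^2 M D. In the q-th power one factor `M` is set aside and
    -- acts as the logarithm, since q ^ M ≤ t.
    N₁-bound : 20 ≤ C → 0 < a → t ^ (q ^ (q * a)) ≤ q ^ t → q ^ ((2 * N₁) ^ q) ≤ t ^ (C ^ q * Z * t ^ w)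
    N₁-bound 20≤C 0<a le = begin
      q ^ ((2 * N₁) ^ q)           ≤⟨ ^-monoʳ-≤ q 2N₁^q≤ ⟩
      q ^ (q * a * W)              ≡⟨ ^-*-assoc q (q * a) W ⟨
      (q ^ (q * a)) ^ W            ≤⟨ ^-monoˡ-≤ W (q^[q*a]≤t 0<a le) ⟩
      t ^ W                        ≤⟨ ^-monoʳ-≤ t (*-monoˡ-≤ (t ^ w) (*-monoˡ-≤ Z (^-monoˡ-≤ q 20≤C))) ⟩
      t ^ (C ^ q * Z * t ^ w)      ∎
      where
      open ≤-Reasoning
      W = 20 ^ q * Z * t ^ w
      p = pred q
      D = q ^ (p * a)
      M = q * a

      q≡1+p : q ≡ suc p
      q≡1+p = sym (suc-pred q)

      q≤D : q ≤ D
      q≤D = ≤-trans (≤-reflexive (sym (^-identityʳ q))) (^-monoʳ-≤ q (*-mono-≤ (pred-mono-≤ 2≤q) 0<a))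

      q^M≡ : q ^ M ≡ q ^ a * D
      q^M≡ = trans (cong (λ z → q ^ (z * a)) q≡1+p) (^-distribˡ-+-* q a (p * a))

      q^t≡ : q ^ t ≡ q ^ a * q ^ h
      q^t≡ = trans (cong (q ^_) (sym t≡)) (^-distribˡ-+-* q a h)

      regroup : ∀ x y D t → 2 * (x * D) * (2 * y * t) ≡ 4 * (D * (x * y) * t)
      regroup = solve-∀
      five : ∀ x → x + 4 * x ≡ 5 * x
      five = solve-∀
      expand : ∀ q M t D x → 2 * (q * (2 * (M * (q * t))) * (5 * (D * x * t))) ≡ 20 * (q * (q * x)) * (t * t) * (M * D)
      expand = solve-∀
      absorb : ∀ x y M s → x * y * (M * s) ≡ M * (x * (y * s))
      absorb = solve-∀
      M-out : ∀ M x y → M * x * y ≡ M * (x * y)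
      M-out = solve-∀
      lin : ∀ q t → (2 + t) * q ≡ q * (t + 2)
      lin = solve-∀
      w≡ : q + q + p ≡ w
      w≡ = cong pred (trans (trans (sym (+-suc (q + q) p)) (trans (cong (q + q +_) (sym q≡1+p)) (three q))) (sym suc-w))
        where
        three : ∀ q → q + q + q ≡ 3 * q
        three = solve-∀

      -- The rich part is absorbed through `q ≤ D`, and the balanced part equals 4 D q^t t; hence
      -- the 5.
      n₁≤ : q * q ^ t * t + 2 * q ^ M * (2 * q ^ h * t) ≤ 5 * (D * q ^ t * t)
      n₁≤ = begin
        q * q ^ t * t + 2 * q ^ M * (2 * q ^ h * t)          ≤⟨ +-monoˡ-≤ _ (*-monoˡ-≤ t (*-monoˡ-≤ (q ^ t) q≤D)) ⟩
        D * q ^ t * t + 2 * q ^ M * (2 * q ^ h * t)          ≡⟨ cong (λ z → D * q ^ t * t + 2 * z * (2 * q ^ h * t)) q^M≡ ⟩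
        D * q ^ t * t + 2 * (q ^ a * D) * (2 * q ^ h * t)    ≡⟨ cong (D * q ^ t * t +_) (regroup (q ^ a) (q ^ h) D t) ⟩
        D * q ^ t * t + 4 * (D * (q ^ a * q ^ h) * t)        ≡⟨ cong (λ z → D * q ^ t * t + 4 * (D * z * t)) (sym q^t≡) ⟩
        D * q ^ t * t + 4 * (D * q ^ t * t)                  ≡⟨ five (D * q ^ t * t) ⟩
        5 * (D * q ^ t * t)                                  ∎

      -- As D ^ q = (q ^ M) ^ p, the power regroups as M (M q^M) ^ p, where the bootstrapped bound M
      -- q^M ≤ t applies.
      [MD]^q≤ : (M * D) ^ q ≤ M * t ^ p
      [MD]^q≤ = begin
        (M * D) ^ q                  ≡⟨ *-^-distrib q M D ⟩
        M ^ q * D ^ q                ≡⟨ cong₂ _*_ (cong (M ^_) q≡1+p) D^q≡ ⟩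
        M * M ^ p * (q ^ M) ^ p      ≡⟨ trans (M-out M (M ^ p) _) (cong (M *_) (sym (*-^-distrib p M (q ^ M)))) ⟩
        M * (M * q ^ M) ^ p          ≤⟨ *-monoʳ-≤ M (^-monoˡ-≤ p ([q*a]*q^[q*a]≤t 0<a le)) ⟩
        M * t ^ p                    ∎
        where
        swap : ∀ p a q → p * a * q ≡ q * a * p
        swap = solve-∀
        D^q≡ : D ^ q ≡ (q ^ M) ^ p
        D^q≡ = trans (^-*-assoc q (p * a) q) (trans (cong (q ^_) (swap p a q)) (sym (^-*-assoc q M p)))

      2N₁^q≤ : (2 * N₁) ^ q ≤ M * W
      2N₁^q≤ = begin
        (2 * N₁) ^ q                                                       ≤⟨ ^-monoˡ-≤ q (*-monoʳ-≤ 2 (*-monoʳ-≤ (q * (2 * (M * (q * t)))) n₁≤)) ⟩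
        (2 * (q * (2 * (M * (q * t))) * (5 * (D * q ^ t * t)))) ^ q        ≡⟨ cong (_^ q) (expand q M t D (q ^ t)) ⟩
        (20 * q ^ (2 + t) * (t * t) * (M * D)) ^ q                         ≡⟨ trans (*-^-distrib q (20 * q ^ (2 + t) * (t * t)) (M * D))
                                                                                (cong (_* (M * D) ^ q) (trans (*-^-distrib q (20 * q ^ (2 + t)) (t * t))
                                                                                  (cong₂ _*_ (*-^-distrib q 20 (q ^ (2 + t))) (*-^-distrib q t t)))) ⟩
        20 ^ q * (q ^ (2 + t)) ^ q * (t ^ q * t ^ q) * (M * D) ^ q         ≡⟨ cong₂ (λ x y → 20 ^ q * x * y * (M * D) ^ q)
                                                                                (trans (^-*-assoc q (2 + t) q) (cong (q ^_) (lin q t)))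
                                                                                (sym (^-distribˡ-+-* t q q)) ⟩
        20 ^ q * Z * t ^ (q + q) * (M * D) ^ q                             ≤⟨ *-monoʳ-≤ (20 ^ q * Z * t ^ (q + q)) [MD]^q≤ ⟩
        20 ^ q * Z * t ^ (q + q) * (M * t ^ p)                             ≡⟨ absorb (20 ^ q * Z) (t ^ (q + q)) M (t ^ p) ⟩
        M * (20 ^ q * Z * (t ^ (q + q) * t ^ p))                           ≡⟨ cong (λ z → M * (20 ^ q * Z * z)) (trans (sym (^-distribˡ-+-* t (q + q) p)) (cong (t ^_) w≡)) ⟩
        M * W                                                              ∎

-- The predicate `Goal` passes to smaller numbers but is not additive, so the sum is bounded by
-- twice its larger term.
double-bound : ∀ M N (P : ℕ → Set) → (∀ {x y} → x ≤ y → P y → P x) → P (2 * M) → P (2 * N) → P (M + N)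
double-bound M N P down pM pN with ≤-total M N
... | inj₁ M≤N = down (≤-trans (+-monoˡ-≤ N M≤N) (≤-reflexive (cong (N +_) (sym (+-identityʳ N))))) pN
... | inj₂ N≤M = down (≤-trans (+-monoʳ-≤ M N≤M) (≤-reflexive (cong (M +_) (sym (+-identityʳ M))))) pM

theorem10 : (q t : ℕ) → 2 ≤ q → 2 ≤ t →
    Σ ℕ λ N → OnlineRamseyKttAtMost q t N ×
    (q ^ (N ^ q) ≤ t ^ ((48 ^ q) * (q ^ (q * (t + 2))) * (t ^ (3 * q ∸ 1))))
theorem10 q t 2≤q 2≤t = play (Parameters.depth 2≤q 2≤t)
  where
  open Parameters 2≤q 2≤t using (module Bounds; [q*a]*q^[q*a]≤t)
  0<q = ≤-trans (s≤s z≤n) 2≤q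
  0<t = ≤-trans (s≤s z≤n) 2≤t
  instance
    q≢0 : NonZero q
    q≢0 = >-nonZero 0<q
  Goal : ℕ → Set
  Goal N = q ^ (N ^ q) ≤ t ^ ((48 ^ q) * (q ^ (q * (t + 2))) * (t ^ (3 * q ∸ 1)))
  Goal-down : ∀ {x y} → x ≤ y → Goal y → Goal x
  Goal-down x≤y = ≤-trans (^-monoʳ-≤ q (^-monoˡ-≤ q x≤y))
  play : (Σ ℕ λ a → t ^ (q ^ (q * a)) ≤ q ^ t × q ^ t < t ^ (q ^ (q * suc a))) → Σ ℕ λ N → OnlineRamseyKttAtMost q t N × Goal N
  -- With `a` zero, q ^ t < t ^ (q ^ q), and the second stage alone meets the bound.
  play (zero , _ , q^t<) = N₂ , one-stage t (second-stage-suffices t t ≤-refl 0<t 0<q refl refl) ,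
    Goal-down (m≤n*m N₂ 2) (N₂-bound (m≤m+n 8 40) q^t<)
    where open Bounds {48} {0} {t} refl
  -- The first stage has to deliver 2 q^h t vertices, the number that the second stage takes as
  -- input for h = t - a.
  play (a@(suc _) , le , q^t<) = N₁ + N₂ ,
    two-stage a h t≡
      (first-stage-suffices (q * a) t (2 * q ^ h * t) (*-mono-≤ 0<q (s≤s z≤n)) qa≤t 0<t 0<q 0<n₂ refl refl)
      (second-stage-suffices h t (m∸n≤m t a) 0<t 0<q refl refl) ,
    double-bound N₁ N₂ Goal Goal-down (N₁-bound (m≤m+n 20 28) (s≤s z≤n) le) (N₂-bound (m≤m+n 8 40) q^t<)
    where
    h = t ∸ a
    0<n₂ : 0 < 2 * q ^ h * t
    0<n₂ = *-mono-≤ (*-mono-≤ {1} {2} (s≤s z≤n) (m^n>0 q h)) 0<t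
    qa≤t : q * a ≤ t
    qa≤t = ≤-trans (m≤m*n (q * a) (q ^ (q * a)) {{m^n≢0 q (q * a)}}) ([q*a]*q^[q*a]≤t (s≤s z≤n) le)
    t≡ : a + h ≡ t
    t≡ = m+[n∸m]≡n (≤-trans (m≤n*m a q) qa≤t)
    open Bounds {48} {a} {h} t≡
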